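{- Let $G$ be a finite simple connected undirected interval graph with at least one edge. Then $2\le \chi_{cf}[G]\le 4$.
   Context: A graph $G$ is an interval graph if there is a family $\{I_v : v\in V(G)\}$ of real intervals such that, for distinct $u,v$, $I_u\cap I_v\neq\emptyset$ if and only if $uv\in E(G)$. Let $N[v]$ be the closed neighborhood of $v$. For a coloring $C_G$ of $V(G)$ (not necessarily proper), a set $U\subseteq V(G)$ has a unique color if there is a color $c$ with $|\{u\in U: C_G(u)=c\}|=1$. The coloring is a conflict-free closed neighborhood (CF-CN) coloring if $N[v]$ has a unique color for every $v\in V(G)$. $\chi_{cf}[G]$ denotes the minimum number of colors in a CF-CN coloring of $G$. -}

module Defs where

open import Data.Fin using (Fin; finToFun; funToFin) renaming (_≟_ to _≟ᶠ_)
open import Data.Fin.Properties using (any?; all?; finToFun-funToFin)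
open import Data.Fin.Subset using (Subset; ∣_∣; _∩_; ⁅_⁆; _∈_)
open import Data.Fin.Subset.Properties
  using (x∈⁅x⁆; x∈⁅y⁆⇒x≡y; ∣⁅x⁆∣≡1; ⊆-antisym; x∈p∩q⁺; x∈p∩q⁻)
open import Data.Nat using (ℕ; zero; suc; _≤_; z≤n; s≤s; _^_)
import Data.Nat as ℕ
open import Data.Product using (∃; ∃-syntax; _×_; _,_; proj₁; proj₂)
open import Data.Rational using (ℚ) renaming (_<_ to _<ℚ_)
open import Data.Sum using (_⊎_; inj₁)
open import Data.Vec using (tabulate)
open import Data.Vec.Properties using (tabulate-cong; lookup⇒[]=; []=⇒lookup; lookup∘tabulate)
open import Function using (_∘_; id; _⇔_)
open import Level using (0ℓ)
open import Relation.Binary.Core using (Rel)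
open import Relation.Binary.Construct.Closure.ReflexiveTransitive using (Star)
open import Relation.Binary.Definitions using (Symmetric; Irreflexive) renaming (Decidable to Decidable₂)
open import Relation.Binary.PropositionalEquality
  using (_≡_; _≢_; _≗_; refl; sym; trans; cong; subst)
open import Relation.Nullary using (¬_; Dec; yes; no; does; contradiction)
open import Relation.Nullary.Decidable using (_⊎-dec_; map′; dec-true)
open import Relation.Unary using (Pred; Decidable; _≬_)

-- A real is a located two-sided Dedekind cut.
record ℝ : Set₁ where
  field
    lower upper     : Pred ℚ 0ℓ
    lower-inhabited : ∃ lower
    upper-inhabited : ∃ upper
    lower-rounded   : ∀ q → lower q ⇔ (∃[ r ] q <ℚ r × lower r)
    upper-rounded   : ∀ q → upper q ⇔ (∃[ r ] r <ℚ q × upper r)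
    disjoint        : ∀ q → ¬ (lower q × upper q)
    located         : ∀ q r → q <ℚ r → lower q ⊎ upper r

infix 4 _≤ℝ_

_≤ℝ_ : Rel ℝ 0ℓ
x ≤ℝ y = ∀ q → ℝ.lower x q → ℝ.lower y q

-- An interval is an order-convex set of reals: open, closed, half-open,
-- bounded and unbounded intervals are all included.
IsInterval : Pred ℝ 0ℓ → Set₁
IsInterval I = ∀ x y z → I x → I z → x ≤ℝ y → y ≤ℝ z → I y

-- adj? makes the edge set a subset of V × V in the classical sense.
record Graph : Set₁ where
  field
    order  : ℕ
    Adj    : Rel (Fin order) 0ℓ
    symm   : Symmetric Adj
    irrefl : Irreflexive _≡_ Adj
    adj?   : Decidable₂ Adj

  V : Set
  V = Fin order

Connected : Graph → Set
Connected G = ∀ u v → Star Adj u v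
  where open Graph G

HasEdge : Graph → Set
HasEdge G = ∃[ u ] ∃[ v ] Adj u v
  where open Graph G

IsIntervalGraph : Graph → Set₁
IsIntervalGraph G =
  ∃ λ (I : V → Pred ℝ 0ℓ) →
    (∀ v → IsInterval (I v)) × (∀ u v → u ≢ v → (I u ≬ I v) ⇔ Adj u v)
  where open Graph G

closedNbhd : ∀ G → Graph.V G → Subset (Graph.order G)
closedNbhd G v = tabulate λ u → does (u ≟ᶠ v ⊎-dec adj? v u)
  where open Graph G

colorClass : ∀ {n k} → (Fin n → Fin k) → Fin k → Subset n
colorClass C c = tabulate λ u → does (C u ≟ᶠ c)

HasUniqueColor : ∀ {n k} → (Fin n → Fin k) → Subset n → Set
HasUniqueColor C U = ∃[ c ] ∣ U ∩ colorClass C c ∣ ≡ 1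

IsCFCN : ∀ (G : Graph) {k} → (Graph.V G → Fin k) → Set
IsCFCN G C = ∀ v → HasUniqueColor C (closedNbhd G v)

-- C need not use every color of Fin k. This does not affect the minimum, since
-- unused colors can be dropped.
CFCNColorable : Graph → ℕ → Set
CFCNColorable G k = ∃[ C ] IsCFCN G {k} C

isCFCN? : ∀ G {k} (C : Graph.V G → Fin k) → Dec (IsCFCN G C)
isCFCN? G C = all? λ v → any? λ c → ∣ closedNbhd G v ∩ colorClass C c ∣ ℕ.≟ 1

isCFCN-resp-≗ : ∀ G {k} {C D : Graph.V G → Fin k} → C ≗ D → IsCFCN G C → IsCFCN G D
isCFCN-resp-≗ G C≗D cf v with cf v
... | c , eq = c , subst (λ S → ∣ closedNbhd G v ∩ S ∣ ≡ 1)
                         (tabulate-cong λ u → cong (λ d → does (d ≟ᶠ c)) (C≗D u)) eq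

cfcnColorable? : ∀ G → Decidable (CFCNColorable G)
cfcnColorable? G k =
  map′ (λ (i , cf) → finToFun i , cf)
       (λ (C , cf) → funToFin C , isCFCN-resp-≗ G (sym ∘ finToFun-funToFin C) cf)
       (any? {n = k ^ Graph.order G} λ i → isCFCN? G (finToFun i))

-- Giving all vertices different colors is a CF-CN coloring.
orderColorable : ∀ G → CFCNColorable G (Graph.order G)
orderColorable G = id , λ v → v , trans (cong ∣_∣ (⊆-antisym (to v) (from v))) (∣⁅x⁆∣≡1 v)
  where
  open Graph G

  to : ∀ v {u} → u ∈ closedNbhd G v ∩ colorClass id v → u ∈ ⁅ v ⁆
  to v {u} u∈ with u ≟ᶠ v | trans (sym (lookup∘tabulate (λ w → does (w ≟ᶠ v)) u))
                              ([]=⇒lookup (proj₂ (x∈p∩q⁻ (closedNbhd G v) (colorClass id v) u∈)))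
  ... | yes refl | _  = x∈⁅x⁆ v
  ... | no _     | ()

  from : ∀ v {u} → u ∈ ⁅ v ⁆ → u ∈ closedNbhd G v ∩ colorClass id v
  from v {u} u∈ with refl ← x∈⁅y⁆⇒x≡y v u∈ = x∈p∩q⁺
    ( lookup⇒[]= v _ (trans (lookup∘tabulate _ v) (dec-true (v ≟ᶠ v ⊎-dec adj? v v) (inj₁ refl)))
    , lookup⇒[]= v _ (trans (lookup∘tabulate _ v) (dec-true (v ≟ᶠ v) refl)) )

IsLeast : ∀ {ℓ} → Pred ℕ ℓ → ℕ → Set ℓ
IsLeast P m = P m × (∀ k → P k → m ≤ k)

least : ∀ {ℓ} {P : Pred ℕ ℓ} → Decidable P → ∀ n → P n → ∃ (IsLeast P)
least P? zero    p = zero , p , λ _ _ → z≤n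
least P? (suc n) p with P? zero
... | yes p₀ = zero , p₀ , λ _ _ → z≤n
... | no ¬p₀ with least (P? ∘ suc) n p
...   | m , pm , min = suc m , pm , λ where
          zero    p₀ → contradiction p₀ ¬p₀
          (suc k) pk → s≤s (min k pk)

leastCFCN : ∀ G → ∃ (IsLeast (CFCNColorable G))
leastCFCN G = least (cfcnColorable? G) (Graph.order G) (orderColorable G)

χcf[_] : Graph → ℕ
χcf[ G ] = proj₁ (leastCFCN G)

χcf-isLeast : ∀ G → IsLeast (CFCNColorable G) χcf[ G ]
χcf-isLeast G = proj₂ (leastCFCN G)

{-# OPTIONS --safe #-}
-- Lower bound: the closed neighbourhood of an end of an edge has two vertices,
-- so with a single color it has no unique color.
--
-- Upper bound: "I u lies to the left of I v" is a strict partial order on the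
-- vertices that compares exactly the pairs of distinct nonadjacent vertices.
-- A walk from a minimal to a maximal vertex dominates the graph: if it avoids
-- N[v], transitivity forces it to stay on one side of v, and it cannot start to
-- the right of v nor end to the left of v.  Take the walk to be a geodesic and
-- color each vertex on it by its distance to the end modulo 3, every other
-- vertex by the fourth color.  Two vertices of N[v] have distances differing by
-- at most 2, so those on the geodesic receive different colors.
--
-- The order of the reals is undecidable, but 4-colorability is decidable, so
-- excluded middle may be used for the finitely many comparisons involved.
module Submission where

open import Defs
open import Data.Fin using (Fin; zero; suc; inject₁; fromℕ; fromℕ<) renaming (_≟_ to _≟ᶠ_)
open import Data.Fin.Induction using (spo-wellFounded; spo-noetherian)
open import Data.Fin.Properties using (any?; sequence; fromℕ<-injective; inject₁-injective; fromℕ≢inject₁)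
open import Data.Fin.Subset using (Subset; ∣_∣; _∩_; ⁅_⁆; _∈_)
open import Data.Fin.Subset.Properties
  using (x∈⁅x⁆; x∈⁅y⁆⇒x≡y; ∣⁅x⁆∣≡1; ⊆-antisym; x∈p∩q⁺; x∈p∩q⁻; x∈p∧x≢y⇒x∈p-y; x∈p⇒∣p-x∣<∣p∣)
open import Data.Nat using (ℕ; zero; suc; _+_; _*_; _%_; _/_; _≤_; _<_; z≤n; s≤s; NonZero)
open import Data.Nat.DivMod using (m≡m%n+[m/n]*n; m%n<n)
open import Data.Nat.Properties
  using (≤-refl; ≤-trans; ≤-antisym; ≤-reflexive; ≤-pred; m≤n⇒m≤1+n; <-irrefl;
         +-comm; +-assoc; +-cancelˡ-<; *-cancelʳ-<; module ≤-Reasoning)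
open import Data.Product using (∃; ∃-syntax; _×_; _,_; proj₁; proj₂; map₂)
import Data.Rational.Properties as ℚ
open import Data.Sum using (_⊎_; inj₁; inj₂)
open import Data.Vec using (tabulate)
open import Data.Vec.Properties using (lookup⇒[]=; []=⇒lookup; lookup∘tabulate)
open import Effect.Monad using (RawMonad)
open import Function using (_∘_; flip; Equivalence)
open import Induction.WellFounded using (WellFounded; Acc; acc)
open import Level using (0ℓ)
open import Relation.Binary using (Rel; IsStrictPartialOrder) renaming (Decidable to Decidable₂)
open import Relation.Binary.Construct.Closure.ReflexiveTransitive using (Star; ε; _◅_)
open import Relation.Binary.Definitions using (tri<; tri≈; tri>)
open import Relation.Binary.PropositionalEquality
  using (_≡_; _≢_; refl; sym; trans; cong; cong₂; subst; isEquivalence; resp₂)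
open import Relation.Nullary using (¬_; Dec; yes; no; does; contradiction)
open import Relation.Nullary.Decidable
  using (_⊎-dec_; _×-dec_; ¬?; map′; dec-true; decidable-stable; ¬¬-excluded-middle)
open import Relation.Nullary.Negation using (¬¬-Monad; ¬¬-map)
open import Relation.Unary using (Pred; Decidable)

-- Numbers with equal remainders

-- The common remainder cancels, leaving `m / d * d < suc (n / d) * d`.
%≡%∧<⇒/≤/ : ∀ {d} .{{_ : NonZero d}} {m n} → m % d ≡ n % d → m < d + n → m / d ≤ n / d
%≡%∧<⇒/≤/ {d} {m} {n} m≡n m<d+n =
  ≤-pred (*-cancelʳ-< d (m / d) (suc (n / d)) (+-cancelˡ-< (n % d) _ _ (begin-strict
    n % d + m / d * d        ≡⟨ cong (_+ m / d * d) (sym m≡n) ⟩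
    m % d + m / d * d        ≡⟨ sym (m≡m%n+[m/n]*n m d) ⟩
    m                        <⟨ m<d+n ⟩
    d + n                    ≡⟨ cong (d +_) (m≡m%n+[m/n]*n n d) ⟩
    d + (n % d + n / d * d)  ≡⟨ sym (+-assoc d _ _) ⟩
    d + n % d + n / d * d    ≡⟨ cong (_+ n / d * d) (+-comm d _) ⟩
    n % d + d + n / d * d    ≡⟨ +-assoc (n % d) d _ ⟩
    n % d + suc (n / d) * d  ∎)))
    where open ≤-Reasoning

%≡%∧<∧<⇒≡ : ∀ {d} .{{_ : NonZero d}} {m n} → m % d ≡ n % d → m < d + n → n < d + m → m ≡ n
%≡%∧<∧<⇒≡ {d} {m} {n} m≡n m<d+n n<d+m =
  trans (m≡m%n+[m/n]*n m d)
    (trans (cong₂ (λ r q → r + q * d) m≡n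
                  (≤-antisym (%≡%∧<⇒/≤/ m≡n m<d+n) (%≡%∧<⇒/≤/ (sym m≡n) n<d+m)))
           (sym (m≡m%n+[m/n]*n n d)))

-- Finite subsets, singletons and minimal elements

module _ {n} {P : Pred (Fin n) 0ℓ} (P? : Decidable P) where

  ∈-tabulate⁺ : ∀ {x} → P x → x ∈ tabulate (does ∘ P?)
  ∈-tabulate⁺ {x} px = lookup⇒[]= x _ (trans (lookup∘tabulate _ x) (dec-true (P? x) px))

  ∈-tabulate⁻ : ∀ {x} → x ∈ tabulate (does ∘ P?) → P x
  ∈-tabulate⁻ {x} x∈ with P? x | trans (sym (lookup∘tabulate (does ∘ P?) x)) ([]=⇒lookup x∈)
  ... | yes px | _  = px
  ... | no _   | ()

∣p∣≡1⇒unique : ∀ {n} {p : Subset n} {x y} → ∣ p ∣ ≡ 1 → x ∈ p → y ∈ p → x ≡ y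
∣p∣≡1⇒unique {x = x} {y} ∣p∣≡1 x∈p y∈p with x ≟ᶠ y
... | yes x≡y = x≡y
-- Deleting `y` and then `x` lowers the size twice, so it was at least 2.
... | no  x≢y with s≤s () ← subst (2 ≤_) ∣p∣≡1
      (≤-trans (s≤s (≤-trans (s≤s z≤n) (x∈p⇒∣p-x∣<∣p∣ (x∈p∧x≢y⇒x∈p-y x∈p x≢y)))) (x∈p⇒∣p-x∣<∣p∣ y∈p))

unique⇒∣p∣≡1 : ∀ {n} {p : Subset n} {x} → x ∈ p → (∀ {y} → y ∈ p → y ≡ x) → ∣ p ∣ ≡ 1
unique⇒∣p∣≡1 {p = p} {x} x∈p unique = trans (cong ∣_∣ (⊆-antisym
    (λ y∈p → subst (_∈ ⁅ x ⁆) (sym (unique y∈p)) (x∈⁅x⁆ x))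
    (λ y∈⁅x⁆ → subst (_∈ p) (sym (x∈⁅y⁆⇒x≡y x y∈⁅x⁆)) x∈p)))
  (∣⁅x⁆∣≡1 x)

module _ {n} {_⊏_ : Rel (Fin n) 0ℓ} (_⊏?_ : Decidable₂ _⊏_) where

  wf⇒minimal : WellFounded _⊏_ → Fin n → ∃[ a ] ∀ v → ¬ v ⊏ a
  wf⇒minimal wf u = go (wf u)
    where
    go : ∀ {u} → Acc _⊏_ u → ∃[ a ] ∀ v → ¬ v ⊏ a
    go {u} (acc rs) with any? (_⊏? u)
    ... | yes (v , v⊏u) = go (rs v⊏u)
    ... | no  ∄v        = u , λ v v⊏u → ∄v (v , v⊏u)

-- Closed neighbourhoods and the lower bound

module _ (G : Graph) where
  open Graph G

  infix 4 _∼_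

  _∼_ : Rel V 0ℓ
  u ∼ v = u ≡ v ⊎ Adj v u

  ∈closedNbhd⁺ : ∀ {u v} → u ∼ v → u ∈ closedNbhd G v
  ∈closedNbhd⁺ {v = v} = ∈-tabulate⁺ (λ u → u ≟ᶠ v ⊎-dec adj? v u)

  ∈closedNbhd⁻ : ∀ {u v} → u ∈ closedNbhd G v → u ∼ v
  ∈closedNbhd⁻ {v = v} = ∈-tabulate⁻ (λ u → u ≟ᶠ v ⊎-dec adj? v u)

  colorable⇒2≤ : HasEdge G → ∀ {k} → CFCNColorable G k → 2 ≤ k
  colorable⇒2≤ (u , v , uv) {zero} (C , _) with () ← C u
  colorable⇒2≤ (u , v , uv) {suc zero} (C , cf) with cf u
  ... | c , eq = contradiction uv (irrefl (∣p∣≡1⇒unique eq (∈N (inj₁ refl)) (∈N (inj₂ uv))))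
    where
    only : ∀ (i j : Fin 1) → i ≡ j
    only zero zero = refl

    ∈N : ∀ {x} → x ∼ u → x ∈ closedNbhd G u ∩ colorClass C c
    ∈N {x} x∼u = x∈p∩q⁺ (∈closedNbhd⁺ x∼u , ∈-tabulate⁺ (λ w → C w ≟ᶠ c) (only (C x) c))
  colorable⇒2≤ _ {suc (suc k)} _ = s≤s (s≤s z≤n)

  -- Walks and distances

  -- With the length as an index, walks of each length can be searched for, so a shortest one can be
  -- found.
  data Walk (b : V) : ℕ → V → Set where
    []  : Walk b 0 b
    _∷_ : ∀ {k u w} → Adj u w → Walk b k w → Walk b (suc k) u

  walk? : ∀ b k u → Dec (Walk b k u)
  walk? b zero    u = map′ (λ { refl → [] }) (λ { [] → refl }) (u ≟ᶠ b)
  walk? b (suc k) u = map′ (λ (_ , e , W) → e ∷ W) (λ { (e ∷ W) → _ , e , W })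
                           (any? λ w → adj? u w ×-dec walk? b k w)

  infix 4 _∈ʷ_ _∈ʷ?_

  _∈ʷ_ : ∀ {b k u} → V → Walk b k u → Set
  _∈ʷ_ {u = u} x []      = x ≡ u
  _∈ʷ_ {u = u} x (_ ∷ W) = x ≡ u ⊎ x ∈ʷ W

  _∈ʷ?_ : ∀ {b k u} x (W : Walk b k u) → Dec (x ∈ʷ W)
  _∈ʷ?_ {u = u} x []      = x ≟ᶠ u
  _∈ʷ?_ {u = u} x (_ ∷ W) = x ≟ᶠ u ⊎-dec x ∈ʷ? W

  star⇒walk : ∀ {u b} → Star Adj u b → ∃[ k ] Walk b k u
  star⇒walk ε        = 0 , []
  star⇒walk (e ◅ es) with star⇒walk es
  ... | k , W = suc k , e ∷ W

  module Distance (connected : Connected G) (b : V) where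

    leastWalk : ∀ u → ∃ (IsLeast λ k → Walk b k u)
    leastWalk u with star⇒walk (connected u b)
    ... | k , W = least (λ j → walk? b j u) k W

    dist : V → ℕ
    dist u = proj₁ (leastWalk u)

    geodesic : ∀ u → Walk b (dist u) u
    geodesic u = proj₁ (proj₂ (leastWalk u))

    dist≤ : ∀ {k u} → Walk b k u → dist u ≤ k
    dist≤ {u = u} = proj₂ (proj₂ (leastWalk u)) _

    dist-adj : ∀ {u v} → Adj u v → dist u ≤ suc (dist v)
    dist-adj uv = dist≤ (uv ∷ geodesic _)

    dist-∼ : ∀ {u v w} → u ∼ v → w ∼ v → dist u ≤ 2 + dist w
    dist-∼ u∼v w∼v = ≤-trans (left u∼v) (s≤s (right w∼v))
      where
      left : ∀ {u v} → u ∼ v → dist u ≤ suc (dist v)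
      left (inj₁ refl) = m≤n⇒m≤1+n ≤-refl
      left (inj₂ vu)   = dist-adj (symm vu)

      right : ∀ {w v} → w ∼ v → dist v ≤ suc (dist w)
      right (inj₁ refl) = m≤n⇒m≤1+n ≤-refl
      right (inj₂ vw)   = dist-adj vw

    -- The part of `W` from `x` onwards is itself a walk to `b`.
    dist-∈ʷ : ∀ {k u x} (W : Walk b k u) → x ∈ʷ W → dist x ≤ k
    dist-∈ʷ []        refl        = dist≤ []
    dist-∈ʷ W@(_ ∷ _) (inj₁ refl) = dist≤ W
    dist-∈ʷ (_ ∷ W)   (inj₂ x∈W)  = m≤n⇒m≤1+n (dist-∈ʷ W x∈W)

    -- The bound `k ≤ dist u` makes `W` a geodesic and passes to its tail. Every vertex of the tail
    -- is closer to `b` than the head is, so distances strictly decrease along `W`.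
    dist-injective : ∀ {k u x y} (W : Walk b k u) → k ≤ dist u →
                     x ∈ʷ W → y ∈ʷ W → dist x ≡ dist y → x ≡ y
    dist-injective []      _  refl        refl        _  = refl
    dist-injective (_ ∷ _) _  (inj₁ refl) (inj₁ refl) _  = refl
    dist-injective (_ ∷ W) k≤ (inj₁ refl) (inj₂ y∈W)  eq =
      contradiction (≤-trans k≤ (≤-trans (≤-reflexive eq) (dist-∈ʷ W y∈W))) (<-irrefl refl)
    dist-injective (_ ∷ W) k≤ (inj₂ x∈W)  (inj₁ refl) eq =
      contradiction (≤-trans k≤ (≤-trans (≤-reflexive (sym eq)) (dist-∈ʷ W x∈W))) (<-irrefl refl)
    dist-injective (e ∷ W) k≤ (inj₂ x∈W)  (inj₂ y∈W)  eq =
      dist-injective W (≤-pred (≤-trans k≤ (dist-adj e))) x∈W y∈W eq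

    -- Coloring along a dominating geodesic

    module _ (a : V) (dominating : ∀ v → ∃[ x ] x ∈ʷ geodesic a × x ∼ v) where

      color : V → Fin 4
      color x with x ∈ʷ? geodesic a
      ... | yes _ = inject₁ (fromℕ< (m%n<n (dist x) 3))
      ... | no  _ = fromℕ 3

      color-injective : ∀ {v x y} → x ∈ʷ geodesic a → x ∼ v → y ∼ v → color y ≡ color x → y ≡ x
      color-injective {x = x} {y} x∈P x∼v y∼v eq with x ∈ʷ? geodesic a | y ∈ʷ? geodesic a
      ... | no x∉P | _       = contradiction x∈P x∉P
      ... | yes _  | no  _   = contradiction eq fromℕ≢inject₁
      ... | yes _  | yes y∈P = dist-injective (geodesic a) ≤-refl y∈P x∈P
        -- Via `v` the two distances differ by at most 2, so equal residues modulo 3 make them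
        -- equal.
        (%≡%∧<∧<⇒≡ (fromℕ<-injective _ _ _ _ (inject₁-injective eq))
                   (s≤s (dist-∼ y∼v x∼v)) (s≤s (dist-∼ x∼v y∼v)))

      dominatingGeodesic⇒4-colorable : CFCNColorable G 4
      dominatingGeodesic⇒4-colorable = color , λ v → let x , x∈P , x∼v = dominating v in
        color x , unique⇒∣p∣≡1
          (x∈p∩q⁺ (∈closedNbhd⁺ x∼v , ∈-tabulate⁺ (λ w → color w ≟ᶠ color x) refl))
          λ y∈ → let y∈N , y∈c = x∈p∩q⁻ (closedNbhd G v) _ y∈ in
            color-injective x∈P x∼v (∈closedNbhd⁻ y∈N) (∈-tabulate⁻ (λ w → color w ≟ᶠ color x) y∈c)

  -- Dominating walks in cocomparability graphs

  module Cocomparability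
    {_≺_ : Rel V 0ℓ} (isSPO : IsStrictPartialOrder _≡_ _≺_) (_≺?_ : Decidable₂ _≺_)
    (≺⇒¬Adj : ∀ {u v} → u ≺ v → ¬ Adj u v)
    (compare : ∀ u v → u ∼ v ⊎ u ≺ v ⊎ v ≺ u) where

    walk-dominates : ∀ {b k u} (W : Walk b k u) v → ¬ v ≺ u → ¬ b ≺ v → ∃[ x ] x ∈ʷ W × x ∼ v
    walk-dominates {u = u} W v v⊀u b⊀v with compare u v
    walk-dominates []      v v⊀u b⊀v | inj₁ u∼v        = _ , refl , u∼v
    walk-dominates (_ ∷ _) v v⊀u b⊀v | inj₁ u∼v        = _ , inj₁ refl , u∼v
    walk-dominates W       v v⊀u b⊀v | inj₂ (inj₂ v≺u) = contradiction v≺u v⊀u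
    walk-dominates []      v v⊀u b⊀v | inj₂ (inj₁ b≺v) = contradiction b≺v b⊀v
    walk-dominates (e ∷ W) v v⊀u b⊀v | inj₂ (inj₁ u≺v)
      -- The next vertex `w` cannot lie to the right of `v`: then `u ≺ v ≺ w` would give `u ≺ w`,
      -- against the edge `e`.
      with walk-dominates W v (λ v≺w → ≺⇒¬Adj (IsStrictPartialOrder.trans isSPO u≺v v≺w) e) b⊀v
    ... | x , x∈W , x∼v = x , inj₂ x∈W , x∼v

    cocomparability⇒4-colorable : Connected G → V → CFCNColorable G 4
    cocomparability⇒4-colorable connected u
      with wf⇒minimal _≺?_ (spo-wellFounded isSPO) u | wf⇒minimal (flip _≺?_) (spo-noetherian isSPO) u
    ... | a , minimal | b , maximal =
      dominatingGeodesic⇒4-colorable a λ v → walk-dominates (geodesic a) v (minimal v) (maximal v)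
      where open Distance connected b

-- Comparing reals

-- Raise a rational `q` below `y` to a larger `r` still below `y`, and locate `x` relative to both.
-- If `r` were above `x`, no rational below `x` could exceed `r`, whence `x ≤ℝ y`.
≰ℝ⇒≥ℝ : ∀ {x y} → ¬ x ≤ℝ y → y ≤ℝ x
≰ℝ⇒≥ℝ {x} {y} x≰y q ly with Equivalence.to (y .ℝ.lower-rounded q) ly
... | r , q<r , lyr with x .ℝ.located q r q<r
...   | inj₁ lxq = lxq
...   | inj₂ uxr = contradiction x≤y x≰y
  where
  x≤y : x ≤ℝ y
  x≤y s lxs with ℚ.<-cmp s r
  ... | tri< s<r _ _  = Equivalence.from (y .ℝ.lower-rounded s) (r , s<r , lyr)
  ... | tri≈ _ refl _ = lyr
  ... | tri> _ _ r<s  =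
    contradiction (Equivalence.from (x .ℝ.lower-rounded r) (s , r<s , lxs) , uxr) (x .ℝ.disjoint r)

-- The left-to-right order of intervals

module Intervals (G : Graph) (interval : IsIntervalGraph G)
                 (point : ∀ v → ∃ (proj₁ interval v)) where
  open Graph G

  private
    I = proj₁ interval

    pt : V → ℝ
    pt = proj₁ ∘ point

    convex : ∀ v → IsInterval (I v)
    convex = proj₁ (proj₂ interval)

    meet⇒adj : ∀ {u v z} → u ≢ v → I u z → I v z → Adj u v
    meet⇒adj u≢v Iuz Ivz = Equivalence.to (proj₂ (proj₂ interval) _ _ u≢v) (_ , Iuz , Ivz)

    adj⇒meet : ∀ {u v} → Adj u v → ∃[ z ] I u z × I v z
    adj⇒meet uv = Equivalence.from (proj₂ (proj₂ interval) _ _ (λ u≡v → irrefl u≡v uv)) uv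

  infix 4 _≺_

  -- Intervals of distinct nonadjacent vertices are disjoint and convex, so one chosen point of each
  -- decides which lies to the left.
  _≺_ : Rel V 0ℓ
  u ≺ v = (u ≢ v × ¬ Adj u v) × pt u ≤ℝ pt v

  module _ (pt≤? : ∀ u v → Dec (pt u ≤ℝ pt v)) where

    _≺?_ : Decidable₂ _≺_
    u ≺? v = (¬? (u ≟ᶠ v) ×-dec ¬? (adj? u v)) ×-dec pt≤? u v

    ≺-trans : ∀ {u v w} → u ≺ v → v ≺ w → u ≺ w
    ≺-trans {u} {v} {w} ((u≢v , ¬uv) , u≤v) ((v≢w , ¬vw) , v≤w) =
      (u≢w , ¬uw) , λ q → v≤w q ∘ u≤v q
      where
      u≢w : u ≢ w
      -- Here `pt v` is squeezed between `pt u` and itself, so convexity puts it into `I u`.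
      u≢w refl = ¬uv (meet⇒adj u≢v (convex u _ _ _ (proj₂ (point u)) (proj₂ (point u)) u≤v v≤w)
                                   (proj₂ (point v)))

      -- A common point of I u and I w lies on one side of pt v, which puts pt v
      -- into I w or into I u.
      ¬uw : ¬ Adj u w
      ¬uw uw with adj⇒meet uw
      ... | z , Iuz , Iwz = ¬z≤pt (≰ℝ⇒≥ℝ {pt v} {z} ¬pt≤z)
        where
        ¬pt≤z : ¬ pt v ≤ℝ z
        ¬pt≤z v≤z = ¬uv (meet⇒adj u≢v (convex u _ _ _ (proj₂ (point u)) Iuz u≤v v≤z) (proj₂ (point v)))

        ¬z≤pt : ¬ z ≤ℝ pt v
        ¬z≤pt z≤v = ¬vw (meet⇒adj v≢w (proj₂ (point v)) (convex w _ _ _ Iwz (proj₂ (point w)) z≤v v≤w))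

    ≺-isStrictPartialOrder : IsStrictPartialOrder _≡_ _≺_
    ≺-isStrictPartialOrder = record
      { isEquivalence = isEquivalence
      ; irrefl        = λ u≡v ((u≢v , _) , _) → u≢v u≡v
      ; trans         = ≺-trans
      ; <-resp-≈      = resp₂ _≺_
      }

    compare : ∀ u v → _∼_ G u v ⊎ u ≺ v ⊎ v ≺ u
    compare u v with u ≟ᶠ v | adj? u v | pt≤? u v
    ... | yes u≡v | _      | _       = inj₁ (inj₁ u≡v)
    ... | no _    | yes uv | _       = inj₁ (inj₂ (symm uv))
    ... | no u≢v  | no ¬uv | yes u≤v = inj₂ (inj₁ ((u≢v , ¬uv) , u≤v))
    ... | no u≢v  | no ¬uv | no  u≰v =
      inj₂ (inj₂ ((u≢v ∘ sym , ¬uv ∘ symm) , ≰ℝ⇒≥ℝ {pt u} {pt v} u≰v))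

    colorable : Connected G → V → CFCNColorable G 4
    colorable = cocomparability⇒4-colorable
      where open Cocomparability G ≺-isStrictPartialOrder _≺?_ (proj₂ ∘ proj₁) compare

  -- Double negation commutes with quantification over `Fin`, so excluded middle for each single
  -- pair suffices.
  ¬¬pt≤? : ¬ ¬ (∀ u v → Dec (pt u ≤ℝ pt v))
  ¬¬pt≤? = ¬¬-sequence λ _ → ¬¬-sequence λ _ → ¬¬-excluded-middle
    where ¬¬-sequence = λ {n} {P} → sequence (RawMonad.rawApplicative ¬¬-Monad) {n} {P}

  interval⇒4-colorable : Connected G → V → CFCNColorable G 4
  interval⇒4-colorable connected u =
    decidable-stable (cfcnColorable? G 4) (¬¬-map (λ pt≤? → colorable pt≤? connected u) ¬¬pt≤?)

-- Provides the nonemptiness of every interval, since adjacent intervals share a point. The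
-- neighbour is the first step of a walk to `s`, or `t` if that walk is empty.
hasNeighbour : ∀ G → Connected G → HasEdge G → ∀ v → ∃[ w ] Graph.Adj G v w
hasNeighbour G connected (s , t , st) v with connected v s
... | ε      = t , st
... | vw ◅ _ = _ , vw

theorem5 : (G : Graph) → IsIntervalGraph G → Connected G → HasEdge G →
    2 ≤ χcf[ G ] × χcf[ G ] ≤ 4
theorem5 G interval@(I , _ , meets) connected edge@(u , _) =
  colorable⇒2≤ G edge (proj₁ (χcf-isLeast G)) ,
  proj₂ (χcf-isLeast G) 4 (Intervals.interval⇒4-colorable G interval point connected u)
  where
  open Graph G

  point : ∀ v → ∃ (I v)
  point v with hasNeighbour G connected edge v
  ... | w , vw = map₂ proj₁ (Equivalence.from (meets v w (λ v≡w → irrefl v≡w vw)) vw)
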